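{- Let $n$ be a positive integer and $d(n)$ the number of positive divisors of $n$. Let $\mathcal{D}_1(n)$ be the set of partitions of $n$ in which only the largest part may be repeated, and let $\mathcal{D}^{\ast}(n)$ be the set of $\pi\in\mathcal{D}_1(n)$ such that the largest part occurs exactly twice and $\#(\pi)\ge 3$. Then \[ d(n) = 1 + \left\lfloor\frac{n}{2}\right\rfloor - \sum_{\pi \in \mathcal{D}^{\ast}(n)} (-1)^{\#(\pi) - 1} \big(s_2(\pi) - s(\pi)\big). \]
   Context: For a partition $\pi$, $\#(\pi)$ is its number of parts, $s(\pi)$ its smallest part, and $s_2(\pi)$ its second smallest part. -}

module Defs where

open import Data.Nat using (ℕ; zero; suc; _+_; _∸_; _≤_; _≥_; _<_; _⊔_)
open import Data.Nat.Divisibility using (_∣?_)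
open import Data.Nat.ListAction using (sum)
open import Data.Nat.Properties using (_≟_)
open import Data.List using (List; []; _∷_; length; filter; applyUpTo; foldr; reverse)
open import Data.List.Relation.Unary.All using (All)
open import Data.List.Relation.Unary.Linked using (Linked)
open import Data.Product using (_×_)
open import Relation.Binary.PropositionalEquality using (_≡_)
open import Data.Integer using (ℤ; +_; _-_; _*_; -1ℤ; _^_)

numDivisors : ℕ → ℕ
numDivisors n = length (filter (λ k → k ∣? n) (applyUpTo suc n))

IsPartition : ℕ → List ℕ → Set
IsPartition n π = All (λ x → 1 ≤ x) π × Linked _≥_ π × sum π ≡ n

count : ℕ → List ℕ → ℕ
count x π = length (filter (x ≟_) π)

numParts : List ℕ → ℕ
numParts = length

largest : List ℕ → ℕ
largest = foldr _⊔_ 0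

IsD1 : ℕ → List ℕ → Set
IsD1 n π = IsPartition n π × (∀ x → 2 ≤ count x π → x ≡ largest π)

IsDStar : ℕ → List ℕ → Set
IsDStar n π = IsD1 n π × count (largest π) π ≡ 2 × 3 ≤ numParts π

-- For a partition listed in nonincreasing order, the smallest part is the
-- last entry and the second smallest part s₂ is the second-to-last entry.
-- (Default 0 for too-short lists; never used on 𝒟*(n), where #(π) ≥ 3.)
smallestRev : List ℕ → ℕ
smallestRev []      = 0
smallestRev (x ∷ _) = x

secondSmallestRev : List ℕ → ℕ
secondSmallestRev []          = 0
secondSmallestRev (_ ∷ [])    = 0
secondSmallestRev (_ ∷ y ∷ _) = y

s : List ℕ → ℕ
s π = smallestRev (reverse π)

s₂ : List ℕ → ℕ
s₂ π = secondSmallestRev (reverse π)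

term : List ℕ → ℤ
term π = (-1ℤ ^ (numParts π ∸ 1)) * ((+ s₂ π) - (+ s π))

sumℤ : List ℤ → ℤ
sumℤ = foldr Data.Integer._+_ (+ 0)

{-# OPTIONS --safe #-}
-- Work with power series in q. Removing the two copies a + 1 of the largest part leaves distinct
-- parts ≤ a; with τ a the signed sum of s₂ − s over these, the sum in question is Σ q^(2a+2) τ a.
-- Splitting on the next part gives τ (a+1) = (1 − qᵃ⁺¹) τ a + (q + ⋯ + qᵃ⁺¹), whose solution satisfies
-- (1 − q) τ N = q Σ_{1≤r≤N} (1 − qʳ)⋯(1 − qᴺ). These two relations telescope the sum, modulo qᴺ, to
--   Σ_{a≤N} qᵃ (q + ⋯ + qᵃ) + (q + ⋯ + qᴺ) + Σ_{1≤r≤N} (1 − qʳ)⋯(1 − qᴺ),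
-- up to the constant term. The first two summands give ⌊n/2⌋ and 1. The third contributes −d(n), because
-- for each l
--   (1 − qˡ⁺¹) Σ_{r≥0} qʳ (1 − qʳ⁺¹)⋯(1 − qʳ⁺ˡ)
-- telescopes to 1, and multiplying by qˡ⁺¹ gives the change of Σ_{r≥0} (1 − (1 − qʳ⁺¹)⋯(1 − qʳ⁺ˡ)) when
-- l increases by 1.
module Submission where

open import Defs
open import Data.Nat using (ℕ; zero; suc; _/_; _∸_; _≤_; _<_; _≥_; _>_; z≤n; s≤s)
import Data.Nat as ℕ
import Data.Nat.Properties as ℕₚ
open import Data.Nat.Divisibility using (_∣_; _∣?_; ∣m+n∣m⇒∣n; ∣m∣n⇒∣m+n; ∣-refl; _∣0; >⇒∤)
open import Data.Nat.DivMod using (m/n≡1+[m∸n]/n)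
open import Data.Nat.Induction using (<-rec)
open import Data.Nat.ListAction using (sum)
open import Data.Integer using (ℤ; +_; _+_; _-_; _*_; -_; _^_; 0ℤ; 1ℤ; -1ℤ)
open import Data.Integer.Properties using (neg-distrib-+; +-assoc; +-comm; +-identityˡ; +-identityʳ; +-inverseʳ)
open import Data.Integer.Tactic.RingSolver using (solve-∀)
open import Data.List using (List; []; _∷_; _++_; map; length; filter; reverse; applyUpTo)
open import Data.List.Properties
  using (unfold-reverse; map-∘; filter-accept; filter-reject; filter-++; length-++; applyUpTo-∷ʳ; ∷-injectiveʳ)
open import Data.List.Relation.Unary.All using (All; []; _∷_)
open import Data.List.Relation.Unary.Any using (here; there)
open import Data.List.Relation.Unary.Linked using (Linked; []; [-]; _∷_)
open import Data.List.Relation.Unary.AllPairs using ([]; _∷_)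
open import Data.List.Relation.Unary.Unique.Propositional using (Unique)
import Data.List.Relation.Unary.Unique.Propositional.Properties as Uniqueₚ
open import Data.List.Relation.Binary.Permutation.Propositional using (_↭_)
import Data.List.Relation.Binary.Permutation.Propositional as ↭
open import Data.List.Relation.Binary.BagAndSetEquality using (∼bag⇒↭)
open import Data.List.Membership.Propositional using (_∈_)
open import Data.List.Membership.Propositional.Properties
  using (∈-++⁺ˡ; ∈-++⁺ʳ; ∈-++⁻; ∈-map⁺; ∈-map⁻; ∈-filter⁺; ∈-filter⁻)
open import Data.List.Membership.Propositional.Properties.WithK using (unique∧set⇒bag)
open import Data.Bool using (if_then_else_)
open import Data.Empty using (⊥)
open import Data.Product using (∃; ∃₂; _×_; _,_)
open import Data.Sum using (inj₁; inj₂)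
open import Function using (_∘_)
open import Function.Bundles using (_⇔_; mk⇔; Equivalence)
open import Relation.Nullary using (¬_; yes; no; does; contradiction)
open import Relation.Unary using (Decidable)
open import Relation.Binary.PropositionalEquality

-- Power series

Series : Set
Series = ℕ → ℤ

-- The type is kept general for two uses: with `d` = 0 this is multiplication by qᵏ on series, and
-- with `d` = [] it translates families of lists of partitions. `shift-natural` connects the two.
shift : {A : Set} → A → ℕ → (ℕ → A) → ℕ → A
shift d zero    f n       = f n
shift d (suc k) f zero    = d
shift d (suc k) f (suc n) = shift d k f n

shift-natural : {A B : Set} (h : A → B) (d : A) (k : ℕ) (f : ℕ → A) (n : ℕ) →
  h (shift d k f n) ≡ shift (h d) k (h ∘ f) n
shift-natural h d zero    f n       = refl
shift-natural h d (suc k) f zero    = refl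
shift-natural h d (suc k) f (suc n) = shift-natural h d k f n

infixr 8 q^_·_
infixl 6 _⊕_

q^_·_ : ℕ → Series → Series
q^ k · f = shift 0ℤ k f

_⊕_ : Series → Series → Series
(f ⊕ g) n = f n + g n

δ : Series
δ zero    = 1ℤ
δ (suc _) = 0ℤ

-- Multiplication by 1 − qᵏ.
Δ : ℕ → Series → Series
Δ k f n = f n - (q^ k · f) n

q·-cong : ∀ k {f g} → f ≗ g → q^ k · f ≗ q^ k · g
q·-cong zero    e n       = e n
q·-cong (suc k) e zero    = refl
q·-cong (suc k) e (suc n) = q·-cong k e n

q·-⊕ : ∀ k f g → q^ k · (f ⊕ g) ≗ q^ k · f ⊕ q^ k · g
q·-⊕ zero    f g n       = refl
q·-⊕ (suc k) f g zero    = refl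
q·-⊕ (suc k) f g (suc n) = q·-⊕ k f g n

q·-minus : ∀ k f g n → (q^ k · (λ m → f m - g m)) n ≡ (q^ k · f) n - (q^ k · g) n
q·-minus zero    f g n       = refl
q·-minus (suc k) f g zero    = refl
q·-minus (suc k) f g (suc n) = q·-minus k f g n

q·-q· : ∀ k l f → q^ k · q^ l · f ≗ q^ (k ℕ.+ l) · f
q·-q· zero    l f n       = refl
q·-q· (suc k) l f zero    = refl
q·-q· (suc k) l f (suc n) = q·-q· k l f n

q·-comm : ∀ k l f → q^ k · q^ l · f ≗ q^ l · q^ k · f
q·-comm k l f n = begin
  (q^ k · q^ l · f) n    ≡⟨ q·-q· k l f n ⟩
  (q^ (k ℕ.+ l) · f) n   ≡⟨ cong (λ i → (q^ i · f) n) (ℕₚ.+-comm k l) ⟩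
  (q^ (l ℕ.+ k) · f) n   ≡⟨ q·-q· l k f n ⟨
  (q^ l · q^ k · f) n    ∎
  where open ≡-Reasoning

q·-low : ∀ {k n} f → n < k → (q^ k · f) n ≡ 0ℤ
q·-low {suc k} {zero}  f _         = refl
q·-low {suc k} {suc n} f (s≤s n<k) = q·-low f n<k

q·-at : ∀ k m f → (q^ k · f) (k ℕ.+ m) ≡ f m
q·-at zero    m f = refl
q·-at (suc k) m f = q·-at k m f

Δ-cong : ∀ k {f g} → f ≗ g → Δ k f ≗ Δ k g
Δ-cong k e n = cong₂ _-_ (e n) (q·-cong k e n)

Δ-⊕ : ∀ k f g → Δ k (f ⊕ g) ≗ Δ k f ⊕ Δ k g
Δ-⊕ k f g n rewrite q·-⊕ k f g n =
  regroup (f n) (g n) ((q^ k · f) n) ((q^ k · g) n)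
  where
  regroup : ∀ a b c d → (a + b) - (c + d) ≡ (a - c) + (b - d)
  regroup = solve-∀

Δ-q· : ∀ k l f → Δ k (q^ l · f) ≗ q^ l · Δ k f
Δ-q· k l f n rewrite q·-minus l f (q^ k · f) n | q·-comm k l f n = refl

Δ-comm : ∀ k l f → Δ k (Δ l f) ≗ Δ l (Δ k f)
Δ-comm k l f n
  rewrite q·-minus k f (q^ l · f) n | q·-minus l f (q^ k · f) n | q·-comm k l f n =
  regroup (f n) ((q^ l · f) n) ((q^ k · f) n) ((q^ l · q^ k · f) n)
  where
  regroup : ∀ a b c d → (a - b) - (c - d) ≡ (a - c) - (b - d)
  regroup = solve-∀

Δ-low : ∀ {k n} f → n < k → Δ k f n ≡ f n
Δ-low {k} {n} f n<k rewrite q·-low f n<k = +-identityʳ (f n)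

-- Finite sums

∑ : ℕ → (ℕ → ℤ) → ℤ
∑ zero    f = 0ℤ
∑ (suc N) f = ∑ N f + f N

∑-cong : ∀ N {f g} → (∀ r → r < N → f r ≡ g r) → ∑ N f ≡ ∑ N g
∑-cong zero    e = refl
∑-cong (suc N) e =
  cong₂ _+_ (∑-cong N λ r r<N → e r (ℕₚ.m<n⇒m<1+n r<N)) (e N ℕₚ.≤-refl)

∑-zero : ∀ N → ∑ N (λ _ → 0ℤ) ≡ 0ℤ
∑-zero zero    = refl
∑-zero (suc N) rewrite ∑-zero N = refl

∑-+ : ∀ N f g → ∑ N (λ r → f r + g r) ≡ ∑ N f + ∑ N g
∑-+ zero    f g = refl
∑-+ (suc N) f g rewrite ∑-+ N f g = regroup (∑ N f) (∑ N g) (f N) (g N)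
  where
  regroup : ∀ a b c d → (a + b) + (c + d) ≡ (a + c) + (b + d)
  regroup = solve-∀

∑-minus : ∀ N f g → ∑ N (λ r → f r - g r) ≡ ∑ N f - ∑ N g
∑-minus zero    f g = refl
∑-minus (suc N) f g rewrite ∑-minus N f g = regroup (∑ N f) (∑ N g) (f N) (g N)
  where
  regroup : ∀ a b c d → (a - b) + (c - d) ≡ (a + c) - (b + d)
  regroup = solve-∀

∑-front : ∀ N f → ∑ (suc N) f ≡ f 0 + ∑ N (f ∘ suc)
∑-front zero    f = +-comm 0ℤ (f 0)
∑-front (suc N) f rewrite ∑-front N f = +-assoc (f 0) (∑ N (f ∘ suc)) (f (suc N))

q·-∑ : ∀ k N (f : ℕ → Series) n →
  (q^ k · (λ m → ∑ N (λ r → f r m))) n ≡ ∑ N (λ r → (q^ k · f r) n)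
q·-∑ zero    N f n       = refl
q·-∑ (suc k) N f zero    = sym (∑-zero N)
q·-∑ (suc k) N f (suc n) = q·-∑ k N f n

-- P j l = (1 − qʲ)(1 − qʲ⁺¹)⋯(1 − qʲ⁺ˡ⁻¹).
P : ℕ → ℕ → Series
P j zero    = δ
P j (suc l) = Δ (j ℕ.+ l) (P j l)

-- `P` grows at the top factor; since the factors commute, the bottom one can be taken out as well.
-- The telescoping in `Δ-G` needs both ends.
P-bottom : ∀ j l → P j (suc l) ≗ Δ j (P (suc j) l)
P-bottom j zero    n rewrite ℕₚ.+-identityʳ j = refl
P-bottom j (suc l) n = begin
  Δ (j ℕ.+ suc l) (P j (suc l)) n         ≡⟨ Δ-cong (j ℕ.+ suc l) (P-bottom j l) n ⟩
  Δ (j ℕ.+ suc l) (Δ j (P (suc j) l)) n   ≡⟨ Δ-comm (j ℕ.+ suc l) j (P (suc j) l) n ⟩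
  Δ j (Δ (j ℕ.+ suc l) (P (suc j) l)) n   ≡⟨ cong (λ i → Δ j (Δ i (P (suc j) l)) n) (ℕₚ.+-suc j l) ⟩
  Δ j (Δ (suc j ℕ.+ l) (P (suc j) l)) n   ∎
  where open ≡-Reasoning

P-low : ∀ {j n} l → n < j → P j l n ≡ δ n
P-low         zero    n<j = refl
P-low {j} {n} (suc l) n<j =
  trans (Δ-low (P j l) (ℕₚ.<-≤-trans n<j (ℕₚ.m≤m+n j l))) (P-low l n<j)

-- Every added factor has exponent at least j + l > n, so it leaves the coefficient of qⁿ alone.
P-stable : ∀ {j l n} k → n < j ℕ.+ l → P j (k ℕ.+ l) n ≡ P j l n
P-stable             zero    n<j+l = refl
P-stable {j} {l} {n} (suc k) n<j+l =
  trans (Δ-low (P j (k ℕ.+ l)) (ℕₚ.<-≤-trans n<j+l (ℕₚ.+-monoʳ-≤ j (ℕₚ.m≤n+m l k))))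
        (P-stable k n<j+l)

-- A truncation of Σ qʳ (1 - qʳ⁺¹)⋯(1 - qʳ⁺ˡ), which agrees with 1/(1 - qˡ⁺¹) below qᴿ.
G : ℕ → ℕ → Series
G l R n = ∑ R (λ r → (q^ r · P (suc r) l) n)

-- Put p = `P (suc R) l`. The sum so far is (1 - qᴿ) p, the new term gives (qᴿ - qᴿ⁺ˡ⁺¹) p, and
-- together they make (1 - qᴿ⁺ˡ⁺¹) p.
Δ-G : ∀ l R → Δ (suc l) (G l R) ≗ P R (suc l)
Δ-G l zero    n
  -- The product starting at 0 vanishes through its factor 1 - q⁰. The empty case of `q·-∑` says
  -- that a shifted zero series is zero.
  rewrite P-bottom 0 l n | q·-∑ (suc l) 0 (λ r → q^ r · P (suc r) l) n = sym (+-inverseʳ (P 1 l n))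
Δ-G l (suc R) n = begin
  Δ (suc l) (G l R ⊕ q^ R · p) n
    ≡⟨ Δ-⊕ (suc l) (G l R) (q^ R · p) n ⟩
  Δ (suc l) (G l R) n + Δ (suc l) (q^ R · p) n
    ≡⟨ cong₂ _+_ (trans (Δ-G l R n) (P-bottom R l n))
                 (cong (λ z → (q^ R · p) n - z)
                   (trans (q·-q· (suc l) R p n)
                          (cong (λ i → (q^ i · p) n) (cong suc (ℕₚ.+-comm l R))))) ⟩
  (p n - (q^ R · p) n) + ((q^ R · p) n - (q^ (suc R ℕ.+ l) · p) n)
    ≡⟨ telescope (p n) ((q^ R · p) n) ((q^ (suc R ℕ.+ l) · p) n) ⟩
  p n - (q^ (suc R ℕ.+ l) · p) n
    ∎
  where
  open ≡-Reasoning
  p = P (suc R) l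
  telescope : ∀ a b c → (a - b) + (b - c) ≡ a - c
  telescope = solve-∀

-- The divisor function

divides01 : ℕ → ℕ → ℤ
divides01 k n = if does (k ∣? n) then 1ℤ else 0ℤ

divides01-yes : ∀ {k n} → k ∣ n → divides01 k n ≡ 1ℤ
divides01-yes {k} {n} k∣n with k ∣? n
... | yes _   = refl
... | no  k∤n = contradiction k∣n k∤n

divides01-no : ∀ {k n} → ¬ k ∣ n → divides01 k n ≡ 0ℤ
divides01-no {k} {n} k∤n with k ∣? n
... | yes k∣n = contradiction k∣n k∤n
... | no  _   = refl

divides01-+ : ∀ k m → divides01 k (k ℕ.+ m) ≡ divides01 k m
divides01-+ k m with k ∣? m
... | yes k∣m = divides01-yes (∣m∣n⇒∣m+n ∣-refl k∣m)
... | no  k∤m = divides01-no λ k∣k+m → k∤m (∣m+n∣m⇒∣n k∣k+m ∣-refl)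

-- The argument is a successor because 0 is a multiple of every `k`.
divides01-low : ∀ {k n} → suc n < k → divides01 k (suc n) ≡ 0ℤ
divides01-low n<k = divides01-no (>⇒∤ n<k)

data Below (k : ℕ) : ℕ → Set where
  low  : ∀ {n} → n < k → Below k n
  high : ∀ m → Below k (k ℕ.+ m)

below? : ∀ k n → Below k n
below? k n with n ℕ.<? k
... | yes n<k = low n<k
... | no  n≮k = subst (Below k) (ℕₚ.m+[n∸m]≡n (ℕₚ.≮⇒≥ n≮k)) (high (n ∸ k))

-- Below qᴿ the product in `Δ-G` is 1, so the coefficients satisfy g(n) = δ(n) + g(n - l - 1), with
-- the last term absent for n ≤ l. The indicator of the multiples of l + 1 obeys the same
-- recurrence.
G-divides : ∀ l R n → n < R → G l R n ≡ divides01 (suc l) n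
G-divides l R = <-rec _ step
  where
  recover : ∀ n → G l R n ≡ P R (suc l) n + (q^ suc l · G l R) n
  recover n = trans (add-back (G l R n) _) (cong (_+ (q^ suc l · G l R) n) (Δ-G l R n))
    where
    add-back : ∀ a b → a ≡ (a - b) + b
    add-back = solve-∀
  step : ∀ n → (∀ {m} → m < n → m < R → G l R m ≡ divides01 (suc l) m) →
         n < R → G l R n ≡ divides01 (suc l) n
  step n ih n<R with below? (suc l) n
  ... | low n<l rewrite recover n | q·-low (G l R) n<l | P-low (suc l) n<R with n
  ...   | zero  = sym (divides01-yes ((suc l) ∣0))
  ...   | suc _ = sym (divides01-low n<l)
  step _ ih n<R | high m
    rewrite recover (suc l ℕ.+ m) | q·-at (suc l) m (G l R) | P-low (suc l) n<R
          | ih {m} (s≤s (ℕₚ.m≤n+m m l)) (ℕₚ.≤-trans (s≤s (ℕₚ.m≤n+m m (suc l))) n<R)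
          | divides01-+ (suc l) m = +-identityˡ (divides01 (suc l) m)

-- Passing from M to M + 1 multiplies the r-th product by 1 - qʳ⁺¹⁺ᴹ. The total removed is qᴹ⁺¹
-- `G M N`, whose coefficient at a positive exponent tests divisibility by M + 1.
∑-P : ∀ N M n → suc n < N →
  ∑ N (λ r → P (suc r) M (suc n)) ≡ - ∑ M (λ k → divides01 (suc k) (suc n))
∑-P N zero    n _   = ∑-zero N
∑-P N (suc M) n n<N = begin
  ∑ N (λ r → P (suc r) M (suc n) - (q^ (suc r ℕ.+ M) · P (suc r) M) (suc n))
    ≡⟨ ∑-minus N _ _ ⟩
  ∑ N (λ r → P (suc r) M (suc n)) - ∑ N (λ r → (q^ (suc r ℕ.+ M) · P (suc r) M) (suc n))
    ≡⟨ cong₂ _-_ (∑-P N M n n<N) row ⟩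
  - ∑ M (λ k → divides01 (suc k) (suc n)) - divides01 (suc M) (suc n)
    ≡⟨ neg-distrib-+ (∑ M (λ k → divides01 (suc k) (suc n))) _ ⟨
  - (∑ M (λ k → divides01 (suc k) (suc n)) + divides01 (suc M) (suc n))
    ∎
  where
  open ≡-Reasoning
  -- Below qᴺ the series (1 - qᴹ⁺¹) `G M N` is 1, so multiplying `G M N` by qᴹ⁺¹ subtracts 1 from
  -- it.
  shifted : ∀ i → i < N → (q^ suc M · G M N) i ≡ divides01 (suc M) i - δ i
  shifted i i<N = trans (sub-back (G M N i) _)
    (cong₂ _-_ (G-divides M N i i<N) (trans (Δ-G M N i) (P-low (suc M) i<N)))
    where
    sub-back : ∀ a b → b ≡ a - (a - b)
    sub-back = solve-∀
  row : ∑ N (λ r → (q^ (suc r ℕ.+ M) · P (suc r) M) (suc n)) ≡ divides01 (suc M) (suc n)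
  row = begin
    ∑ N (λ r → (q^ (suc r ℕ.+ M) · P (suc r) M) (suc n))
      ≡⟨ ∑-cong N (λ r _ → trans (cong (λ i → (q^ suc i · P (suc r) M) (suc n)) (ℕₚ.+-comm r M))
                                 (sym (q·-q· (suc M) r (P (suc r) M) (suc n)))) ⟩
    ∑ N (λ r → (q^ suc M · q^ r · P (suc r) M) (suc n))
      ≡⟨ q·-∑ (suc M) N (λ r → q^ r · P (suc r) M) (suc n) ⟨
    (q^ suc M · G M N) (suc n)
      ≡⟨ shifted (suc n) n<N ⟩
    divides01 (suc M) (suc n) - 0ℤ
      ≡⟨ +-identityʳ _ ⟩
    divides01 (suc M) (suc n)
      ∎

-- The recurrence is the one that (1 - q) `τ N` satisfies up to a factor q; `v-∑P` solves it as the
-- sum of the products (1 - qʳ)⋯(1 - qᴺ), 1 ≤ r ≤ N.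
v : ℕ → Series
v zero    = λ _ → 0ℤ
v (suc N) = Δ (suc N) (v N ⊕ δ)

v-∑P : ∀ N n → v N n ≡ ∑ N (λ r → P (suc r) (N ∸ r) n)
v-∑P zero    n = refl
v-∑P (suc N) n = begin
  Δ (suc N) (v N ⊕ δ) n
    ≡⟨ Δ-⊕ (suc N) (v N) δ n ⟩
  Δ (suc N) (v N) n + Δ (suc N) δ n
    ≡⟨ cong (_+ Δ (suc N) δ n) (Δ-cong (suc N) (v-∑P N) n) ⟩
  Δ (suc N) (λ m → ∑ N (λ r → P (suc r) (N ∸ r) m)) n + Δ (suc N) δ n
    ≡⟨ cong (λ z → (∑ N (λ r → P (suc r) (N ∸ r) n) - z) + Δ (suc N) δ n) (q·-∑ (suc N) N (λ r → P (suc r) (N ∸ r)) n) ⟩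
  (∑ N (λ r → P (suc r) (N ∸ r) n) - ∑ N (λ r → (q^ suc N · P (suc r) (N ∸ r)) n)) + Δ (suc N) δ n
    ≡⟨ cong (_+ Δ (suc N) δ n) (∑-minus N _ _) ⟨
  ∑ N (λ r → Δ (suc N) (P (suc r) (N ∸ r)) n) + Δ (suc N) δ n
    ≡⟨ cong₂ _+_ (∑-cong N extend) last ⟩
  ∑ N (λ r → P (suc r) (suc N ∸ r) n) + P (suc N) (suc N ∸ N) n
    ∎
  where
  open ≡-Reasoning
  extend : ∀ r → r < N → Δ (suc N) (P (suc r) (N ∸ r)) n ≡ P (suc r) (suc N ∸ r) n
  extend r r<N
    rewrite ℕₚ.+-∸-assoc 1 (ℕₚ.<⇒≤ r<N) | ℕₚ.m+[n∸m]≡n (ℕₚ.<⇒≤ r<N) = refl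
  last : Δ (suc N) δ n ≡ P (suc N) (suc N ∸ N) n
  last rewrite ℕₚ.m+n∸n≡m 1 N | ℕₚ.+-identityʳ N = refl

-- The products in `v-∑P` have different lengths. Extending all of them to length N adds only
-- factors with exponents above N, which is invisible at this coefficient and makes `∑-P`
-- applicable.
v-divides : ∀ N n → suc n < N → v N (suc n) ≡ - ∑ N (λ k → divides01 (suc k) (suc n))
v-divides N n n<N = trans (v-∑P N (suc n)) (trans (∑-cong N stable) (∑-P N N n n<N))
  where
  stable : ∀ r → r < N → P (suc r) (N ∸ r) (suc n) ≡ P (suc r) N (suc n)
  stable r r<N = begin
    P (suc r) (N ∸ r) (suc n)            ≡⟨ P-stable {suc r} {N ∸ r} r bound ⟨
    P (suc r) (r ℕ.+ (N ∸ r)) (suc n)    ≡⟨ cong (λ i → P (suc r) i (suc n)) (ℕₚ.m+[n∸m]≡n (ℕₚ.<⇒≤ r<N)) ⟩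
    P (suc r) N (suc n)                  ∎
    where
    open ≡-Reasoning
    bound : suc n < suc r ℕ.+ (N ∸ r)
    bound rewrite ℕₚ.m+[n∸m]≡n (ℕₚ.<⇒≤ r<N) = ℕₚ.m<n⇒m<1+n n<N

-- Geometric segments and the term ⌊n/2⌋

-- seg k = q + q² + ⋯ + qᵏ.
seg : ℕ → Series
seg zero    = λ _ → 0ℤ
seg (suc k) = q^ 1 · (δ ⊕ seg k)

seg-last : ∀ k → seg (suc k) ≗ seg k ⊕ q^ suc k · δ
seg-last zero    zero    = refl
seg-last zero    (suc n) = +-comm (δ n) 0ℤ
seg-last (suc k) zero    = refl
seg-last (suc k) (suc n) rewrite seg-last k n = sym (+-assoc (δ n) (seg k n) ((q^ suc k · δ) n))

seg-∑ : ∀ k n → seg k n ≡ ∑ k (λ a → (q^ suc a · δ) n)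
seg-∑ zero    n = refl
seg-∑ (suc k) n = trans (seg-last k n) (cong (_+ (q^ suc k · δ) n) (seg-∑ k n))

seg-zero : ∀ k → seg k 0 ≡ 0ℤ
seg-zero zero    = refl
seg-zero (suc k) = refl

seg-one : ∀ {k n} → suc n ≤ k → seg k (suc n) ≡ 1ℤ
seg-one {suc k} {zero}  _         rewrite seg-zero k = refl
seg-one {suc k} {suc n} (s≤s n≤k) rewrite seg-one n≤k = refl

Δ1-seg : ∀ k → Δ 1 (seg k) ≗ q^ 1 · Δ k δ
Δ1-seg k n = begin
  seg k n - (q^ 1 · seg k) n
    -- Adding q to both sides of the difference turns q · `seg k` into `seg (suc k)`, which exceeds
    -- `seg k` by its top term only.
    ≡⟨ insert (seg k n) ((q^ 1 · seg k) n) ((q^ 1 · δ) n) ⟩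
  (q^ 1 · δ) n + seg k n - ((q^ 1 · δ) n + (q^ 1 · seg k) n)
    ≡⟨ cong (λ z → (q^ 1 · δ) n + seg k n - z) (trans (sym (q·-⊕ 1 δ (seg k) n)) (seg-last k n)) ⟩
  (q^ 1 · δ) n + seg k n - (seg k n + (q^ suc k · δ) n)
    ≡⟨ cancel ((q^ 1 · δ) n) (seg k n) _ ⟩
  (q^ 1 · δ) n - (q^ suc k · δ) n
    ≡⟨ cong (λ z → (q^ 1 · δ) n - z) (q·-q· 1 k δ n) ⟨
  (q^ 1 · δ) n - (q^ 1 · q^ k · δ) n
    ≡⟨ q·-minus 1 δ (q^ k · δ) n ⟨
  (q^ 1 · Δ k δ) n
    ∎
  where
  open ≡-Reasoning
  insert : ∀ a b c → a - b ≡ c + a - (c + b)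
  insert = solve-∀
  cancel : ∀ a b c → a + b - (b + c) ≡ a - c
  cancel = solve-∀

H : ℕ → Series
H N n = ∑ N (λ a → (q^ suc a · seg (suc a)) n)

-- The terms of H N are q^(a+i) with 1 ≤ i ≤ a ≤ N; raising both a and i by 1 reaches all but i = 1.
H-step : ∀ N n → H (suc N) (suc (suc n)) ≡ seg (suc N) (suc n) + H N n
H-step N n = begin
  H (suc N) (suc (suc n))
    ≡⟨ ∑-front N (λ a → (q^ suc a · seg (suc a)) (suc (suc n))) ⟩
  (δ n + 0ℤ) + ∑ N (λ a → (q^ a · q^ 1 · (δ ⊕ seg (suc a))) n)
    ≡⟨ cong₂ _+_ (+-identityʳ (δ n)) (trans (∑-cong N λ a _ → split a) (∑-+ N _ _)) ⟩
  δ n + (∑ N (λ a → (q^ suc a · δ) n) + H N n)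
    ≡⟨ cong (λ z → δ n + (z + H N n)) (seg-∑ N n) ⟨
  δ n + (seg N n + H N n)
    ≡⟨ +-assoc (δ n) (seg N n) (H N n) ⟨
  δ n + seg N n + H N n
    ∎
  where
  open ≡-Reasoning
  split : ∀ a → (q^ a · q^ 1 · (δ ⊕ seg (suc a))) n
              ≡ (q^ suc a · δ) n + (q^ suc a · seg (suc a)) n
  split a = begin
    (q^ a · q^ 1 · (δ ⊕ seg (suc a))) n       ≡⟨ q·-comm a 1 _ n ⟩
    (q^ 1 · q^ a · (δ ⊕ seg (suc a))) n       ≡⟨ q·-q· 1 a _ n ⟩
    (q^ suc a · (δ ⊕ seg (suc a))) n          ≡⟨ q·-⊕ (suc a) δ (seg (suc a)) n ⟩
    (q^ suc a · δ) n + (q^ suc a · seg (suc a)) n ∎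

-- The coefficient counts the partitions of n into two positive parts. By `H-step`, going from n to
-- n + 2 adds one coefficient of a segment, which is 1 in this range.
H-half : ∀ N n → n ≤ N → H N n ≡ + (n / 2)
H-half N zero _ = trans (∑-cong N λ _ _ → refl) (∑-zero N)
H-half (suc N) (suc zero) _ =
  trans (∑-front N (λ a → (q^ suc a · seg (suc a)) 1))
        (cong (λ z → 0ℤ + z) (trans (∑-cong N λ _ _ → refl) (∑-zero N)))
H-half (suc N) (suc (suc n)) (s≤s n<N)
  rewrite H-step N n | seg-one {suc N} {n} (ℕₚ.m≤n⇒m≤1+n n<N) | H-half N n (ℕₚ.<⇒≤ n<N)
        | m/n≡1+[m∸n]/n {suc (suc n)} {2} (s≤s (s≤s z≤n)) = refl

-- The signed sum over partitions

s-tail : ∀ x y l → s (x ∷ y ∷ l) ≡ s (y ∷ l)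
s-tail x y l rewrite unfold-reverse x (y ∷ l) | unfold-reverse y l with reverse l
... | []    = refl
... | _ ∷ _ = refl

s₂-tail : ∀ x y z l → s₂ (x ∷ y ∷ z ∷ l) ≡ s₂ (y ∷ z ∷ l)
s₂-tail x y z l
  rewrite unfold-reverse x (y ∷ z ∷ l) | unfold-reverse y (z ∷ l) | unfold-reverse z l
  with reverse l
... | []        = refl
... | _ ∷ []    = refl
... | _ ∷ _ ∷ _ = refl

isEmpty : List ℕ → ℤ
isEmpty []      = 1ℤ
isEmpty (_ ∷ _) = 0ℤ

term-pair : ∀ t → term (t ∷ t ∷ []) ≡ 0ℤ
term-pair t = cancel -1ℤ (+ t)
  where
  cancel : ∀ a b → a * (b - b) ≡ 0ℤ
  cancel = solve-∀

-- If `B` is nonempty, the two smallest parts lie in `b ∷ B`, and dropping one part flips the sign.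
-- If `B` is empty, the two smallest parts are t and b, while the pair (b, b) has term 0.
term-∷ : ∀ t b B →
  term (t ∷ t ∷ b ∷ B) ≡ isEmpty B * (+ t - + b) - term (b ∷ b ∷ B)
term-∷ t b []      = trans (regroup (+ t) (+ b)) (cong (λ z → 1ℤ * (+ t - + b) - z) (sym (term-pair b)))
  where
  regroup : ∀ t b → 1ℤ * (t - b) ≡ 1ℤ * (t - b) - 0ℤ
  regroup = solve-∀
term-∷ t b (c ∷ B)
  rewrite s-tail t t (b ∷ c ∷ B) | s-tail t b (c ∷ B)
        | s-tail b b (c ∷ B)
        | s₂-tail t t b (c ∷ B) | s₂-tail t b c B
        | s₂-tail b b c B =
  regroup (-1ℤ ^ suc (suc (length B))) (+ s₂ (b ∷ c ∷ B)) (+ s (b ∷ c ∷ B)) (+ t - + b)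
  where
  regroup : ∀ p x y z → - 1ℤ * p * (x - y) ≡ 0ℤ * z - p * (x - y)
  regroup = solve-∀

-- Signed sums over lists

module _ {A : Set} where

  lsum : (A → ℤ) → List A → ℤ
  lsum f l = sumℤ (map f l)

  lsum-++ : ∀ f (l l′ : List A) → lsum f (l ++ l′) ≡ lsum f l + lsum f l′
  lsum-++ f []      l′ = sym (+-identityˡ _)
  lsum-++ f (x ∷ l) l′ =
    trans (cong (λ z → f x + z) (lsum-++ f l l′)) (sym (+-assoc (f x) (lsum f l) (lsum f l′)))

  lsum-cong : ∀ {f g : A → ℤ} → f ≗ g → ∀ l → lsum f l ≡ lsum g l
  lsum-cong e []      = refl
  lsum-cong e (x ∷ l) = cong₂ _+_ (e x) (lsum-cong e l)

  lsum-zero : ∀ l → lsum (λ (_ : A) → 0ℤ) l ≡ 0ℤ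
  lsum-zero []      = refl
  lsum-zero (x ∷ l) rewrite lsum-zero l = refl

  lsum-*-minus : ∀ (f g : A → ℤ) c l →
    lsum (λ x → f x * c - g x) l ≡ lsum f l * c - lsum g l
  lsum-*-minus f g c []      = refl
  lsum-*-minus f g c (x ∷ l) rewrite lsum-*-minus f g c l =
    regroup (f x) (g x) c (lsum f l) (lsum g l)
    where
    regroup : ∀ a b c d e → (a * c - b) + (d * c - e) ≡ (a + d) * c - (b + e)
    regroup = solve-∀

  lsum-↭ : ∀ f {l l′ : List A} → l ↭ l′ → lsum f l ≡ lsum f l′
  lsum-↭ f ↭.refl          = refl
  lsum-↭ f (↭.prep x p)    = cong (λ z → f x + z) (lsum-↭ f p)
  lsum-↭ f (↭.swap {l} {l′} x y p) rewrite lsum-↭ f p = exchange (f x) (f y) (lsum f l′)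
    where
    exchange : ∀ a b c → a + (b + c) ≡ b + (a + c)
    exchange = solve-∀
  lsum-↭ f (↭.trans p q)   = trans (lsum-↭ f p) (lsum-↭ f q)

  lsum-filter : ∀ f {Q : A → Set} (Q? : Decidable Q) l →
    (∀ {x} → x ∈ l → ¬ Q x → f x ≡ 0ℤ) → lsum f (filter Q? l) ≡ lsum f l
  lsum-filter f Q? []      zeros = refl
  lsum-filter f Q? (x ∷ l) zeros with Q? x | lsum-filter f Q? l (zeros ∘ there)
  ... | yes _  | ih = cong (λ z → f x + z) ih
  ... | no  ¬q | ih rewrite zeros (here refl) ¬q = trans ih (sym (+-identityˡ _))

lsum-map : ∀ {A B : Set} (f : B → ℤ) (g : A → B) l → lsum f (map g l) ≡ lsum (f ∘ g) l
lsum-map f g l = cong sumℤ (sym (map-∘ l))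

lsum-shift : ∀ {A B : Set} (f : B → ℤ) k (g : A → B) (h : ℕ → List A) n →
  lsum f (shift [] k (map g ∘ h) n) ≡ (q^ k · (λ m → lsum (f ∘ g) (h m))) n
lsum-shift f k g h n =
  trans (shift-natural (lsum f) [] k (map g ∘ h) n) (q·-cong k (λ m → lsum-map f g (h m)) n)

-- Partitions into distinct parts at most `a`, and the recurrence for `τ`

strict : ℕ → ℕ → List (List ℕ)
strict zero    zero    = [] ∷ []
strict zero    (suc _) = []
strict (suc a) m       = strict a m ++ shift [] (suc a) (map (suc a ∷_) ∘ strict a) m

lsum-isEmpty : ∀ a m → lsum isEmpty (strict a m) ≡ δ m
lsum-isEmpty zero    zero    = refl
lsum-isEmpty zero    (suc m) = refl
lsum-isEmpty (suc a) m = begin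
  lsum isEmpty (strict a m ++ shift [] (suc a) (map (suc a ∷_) ∘ strict a) m)
    ≡⟨ lsum-++ isEmpty (strict a m) _ ⟩
  lsum isEmpty (strict a m) + lsum isEmpty (shift [] (suc a) (map (suc a ∷_) ∘ strict a) m)
    ≡⟨ cong₂ _+_ (lsum-isEmpty a m) (lsum-shift isEmpty (suc a) (suc a ∷_) (strict a) m) ⟩
  δ m + (q^ suc a · (λ k → lsum (λ _ → 0ℤ) (strict a k))) m
    ≡⟨ cong (λ z → δ m + z) (trans (q·-cong (suc a) (λ k → lsum-zero (strict a k)) m)
                                  (q·-∑ (suc a) 0 (λ _ → δ) m)) ⟩
  δ m + 0ℤ
    ≡⟨ +-identityʳ (δ m) ⟩
  δ m
    ∎
  where
  open ≡-Reasoning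

-- The exponent records the sum of `B` alone, without the two copies of t. Keeping t independent of
-- a lets the bound on `B` and the repeated part be raised separately.
U : ℕ → ℕ → Series
U t a m = lsum (λ B → term (t ∷ t ∷ B)) (strict a m)

τ : ℕ → Series
τ a = U (suc a) a

-- Lists without the part a + 1 give `U t a`. For those headed by a + 1, `term-∷` replaces t by a +
-- 1, which yields -`τ a`, with a correction only when a + 1 stands alone.
U-suc : ∀ t a m →
  U t (suc a) m ≡ U t a m + ((q^ suc a · δ) m * (+ t - + suc a) - (q^ suc a · τ a) m)
U-suc t a m = begin
  U t (suc a) m
    ≡⟨ lsum-++ (λ B → term (t ∷ t ∷ B)) (strict a m) _ ⟩
  U t a m + lsum (λ B → term (t ∷ t ∷ B)) (shift [] (suc a) (map (suc a ∷_) ∘ strict a) m)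
    ≡⟨ cong (λ z → U t a m + z)
            (lsum-shift (λ B → term (t ∷ t ∷ B)) (suc a) (suc a ∷_) (strict a) m) ⟩
  U t a m + (q^ suc a · (λ k → lsum (λ B → term (t ∷ t ∷ suc a ∷ B)) (strict a k))) m
    ≡⟨ cong (λ z → U t a m + z) (q·-cong (suc a) split m) ⟩
  U t a m + (q^ suc a · (λ k → δ k * c - τ a k)) m
    ≡⟨ cong (λ z → U t a m + z) (q·-minus (suc a) (λ k → δ k * c) (τ a) m) ⟩
  U t a m + ((q^ suc a · (λ k → δ k * c)) m - (q^ suc a · τ a) m)
    ≡⟨ cong (λ z → U t a m + (z - (q^ suc a · τ a) m)) (shift-natural (_* c) 0ℤ (suc a) δ m) ⟨
  U t a m + ((q^ suc a · δ) m * c - (q^ suc a · τ a) m)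
    ∎
  where
  open ≡-Reasoning
  c = + t - + suc a
  split : ∀ k → lsum (λ B → term (t ∷ t ∷ suc a ∷ B)) (strict a k) ≡ δ k * c - τ a k
  split k = begin
    lsum (λ B → term (t ∷ t ∷ suc a ∷ B)) (strict a k)
      ≡⟨ lsum-cong (term-∷ t (suc a)) (strict a k) ⟩
    lsum (λ B → isEmpty B * c - term (suc a ∷ suc a ∷ B)) (strict a k)
      ≡⟨ lsum-*-minus isEmpty (λ B → term (suc a ∷ suc a ∷ B)) c (strict a k) ⟩
    lsum isEmpty (strict a k) * c - τ a k
      ≡⟨ cong (λ z → z * c - τ a k) (lsum-isEmpty a k) ⟩
    δ k * c - τ a k
      ∎

U-zero : ∀ t m → U t 0 m ≡ 0ℤ
U-zero t zero    = cong (λ z → z + 0ℤ) (term-pair t)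
U-zero t (suc m) = refl

-- The value t enters a term only when `B` is a single part b ≤ a, where the term is t - b. Raising
-- t thus adds one qᵇ for each such b.
U-raise : ∀ t a m → U (suc t) a m ≡ U t a m + seg a m
U-raise t zero    m rewrite U-zero (suc t) m | U-zero t m = refl
U-raise t (suc a) m
  rewrite U-suc (suc t) a m | U-suc t a m | U-raise t a m | seg-last a m =
  regroup (U t a m) (seg a m) ((q^ suc a · δ) m) (+ t) (+ suc a) ((q^ suc a · τ a) m)
  where
  regroup : ∀ u g d t b x →
    u + g + (d * ((1ℤ + t) - b) - x) ≡ u + (d * (t - b) - x) + (g + d)
  regroup = solve-∀

-- First raise t from a + 1 to a + 2, then split on the part a + 1: at t = a + 1 the correction in
-- `U-suc` is zero.
τ-suc : ∀ a → τ (suc a) ≗ Δ (suc a) (τ a) ⊕ seg (suc a)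
τ-suc a m rewrite U-raise (suc a) (suc a) m | U-suc (suc a) a m =
  regroup (τ a m) ((q^ suc a · δ) m) (+ suc a) ((q^ suc a · τ a) m) (seg (suc a) m)
  where
  regroup : ∀ u d b x g → u + (d * (b - b) - x) + g ≡ u - x + g
  regroup = solve-∀

-- Multiplying `τ-suc` by 1 - q collapses the segment to q (1 - qᴺ⁺¹), and what results is the
-- recurrence of `v` times q.
Δ1-τ : ∀ N → Δ 1 (τ N) ≗ q^ 1 · v N
Δ1-τ zero    zero          = refl
Δ1-τ zero    (suc zero)    = refl
Δ1-τ zero    (suc (suc m)) = refl
Δ1-τ (suc N) m = begin
  Δ 1 (τ (suc N)) m
    ≡⟨ Δ-cong 1 (τ-suc N) m ⟩
  Δ 1 (Δ (suc N) (τ N) ⊕ seg (suc N)) m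
    ≡⟨ Δ-⊕ 1 (Δ (suc N) (τ N)) (seg (suc N)) m ⟩
  Δ 1 (Δ (suc N) (τ N)) m + Δ 1 (seg (suc N)) m
    ≡⟨ cong₂ _+_ (trans (Δ-comm 1 (suc N) (τ N) m)
                 (trans (Δ-cong (suc N) (Δ1-τ N) m)
                        (Δ-q· (suc N) 1 (v N) m)))
                 (Δ1-seg (suc N) m) ⟩
  (q^ 1 · Δ (suc N) (v N)) m + (q^ 1 · Δ (suc N) δ) m
    ≡⟨ q·-⊕ 1 (Δ (suc N) (v N)) (Δ (suc N) δ) m ⟨
  (q^ 1 · (Δ (suc N) (v N) ⊕ Δ (suc N) δ)) m
    ≡⟨ q·-cong 1 (Δ-⊕ (suc N) (v N) δ) m ⟨
  (q^ 1 · v (suc N)) m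
    ∎
  where open ≡-Reasoning

-- Telescoping the sum of q²ᵃ⁺² `τ a`

q·-v : ∀ N n → (q^ suc N · v N) n ≡ (q^ N · τ N) n - (q^ suc N · τ N) n
q·-v N n = begin
  (q^ suc N · v N) n                         ≡⟨ q·-q· 1 N (v N) n ⟨
  (q^ 1 · q^ N · v N) n                      ≡⟨ q·-comm 1 N (v N) n ⟩
  (q^ N · q^ 1 · v N) n                      ≡⟨ q·-cong N (Δ1-τ N) n ⟨
  (q^ N · Δ 1 (τ N)) n                       ≡⟨ Δ-q· 1 N (τ N) n ⟨
  (q^ N · τ N) n - (q^ 1 · q^ N · τ N) n     ≡⟨ cong (λ z → (q^ N · τ N) n - z) (q·-q· 1 N (τ N) n) ⟩
  (q^ N · τ N) n - (q^ suc N · τ N) n        ∎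
  where open ≡-Reasoning

q·-τ-suc : ∀ N k n → (q^ k · τ (suc N)) n
  ≡ ((q^ k · τ N) n - (q^ (k ℕ.+ suc N) · τ N) n) + (q^ k · seg (suc N)) n
q·-τ-suc N k n = begin
  (q^ k · τ (suc N)) n
    ≡⟨ q·-cong k (τ-suc N) n ⟩
  (q^ k · (Δ (suc N) (τ N) ⊕ seg (suc N))) n
    ≡⟨ q·-⊕ k (Δ (suc N) (τ N)) (seg (suc N)) n ⟩
  (q^ k · Δ (suc N) (τ N)) n + (q^ k · seg (suc N)) n
    ≡⟨ cong (λ z → z + (q^ k · seg (suc N)) n) (q·-minus k (τ N) (q^ suc N · τ N) n) ⟩
  ((q^ k · τ N) n - (q^ k · q^ suc N · τ N) n) + (q^ k · seg (suc N)) n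
    ≡⟨ cong (λ z → ((q^ k · τ N) n - z) + (q^ k · seg (suc N)) n) (q·-q· k (suc N) (τ N) n) ⟩
  ((q^ k · τ N) n - (q^ (k ℕ.+ suc N) · τ N) n) + (q^ k · seg (suc N)) n
    ∎
  where open ≡-Reasoning

-- When N grows, `q·-v` rewrites the change in `v` through `τ N`, and `q·-τ-suc` does the same for
-- the remainder; everything cancels except q²ᴺ⁺² `τ N`. Taking the exponent positive discards the
-- constant 1 that each step adds to `v`.
∑-τ : ∀ N n →
  ∑ N (λ a → (q^ (suc a ℕ.+ suc a) · τ a) (suc n))
    ≡ H N (suc n) + seg N (suc n) + v N (suc n) - (q^ N · τ N) (suc n)
∑-τ zero    n = refl
∑-τ (suc N) n
  rewrite ∑-τ N n | seg-last N (suc n) | Δ-⊕ (suc N) (v N) δ (suc n)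
        | q·-τ-suc N (suc N) (suc n) | q·-v N (suc n) =
  regroup (H N (suc n)) (seg N (suc n)) (v N (suc n))
          ((q^ N · τ N) (suc n)) ((q^ suc N · τ N) (suc n))
          ((q^ (suc N ℕ.+ suc N) · τ N) (suc n)) ((q^ suc N · seg (suc N)) (suc n))
          ((q^ suc N · δ) (suc n))
  where
  regroup : ∀ h g v x x′ y z d →
    h + g + v - x + y ≡ h + z + (g + d) + (v - (x - x′) + (0ℤ - d)) - (x′ - y + z)
  regroup = solve-∀

doubled : ℕ → ℕ → List (List ℕ)
doubled zero    n = []
doubled (suc a) n =
  doubled a n ++ shift [] (suc a ℕ.+ suc a) (map (λ B → suc a ∷ suc a ∷ B) ∘ strict a) n

lsum-doubled : ∀ N n → lsum term (doubled N n) ≡ ∑ N (λ a → (q^ (suc a ℕ.+ suc a) · τ a) n)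
lsum-doubled zero    n = refl
lsum-doubled (suc a) n =
  trans (lsum-++ term (doubled a n) _)
        (cong₂ _+_ (lsum-doubled a n)
                   (lsum-shift term (suc a ℕ.+ suc a) (λ B → suc a ∷ suc a ∷ B) (strict a) n))

numDivisors-∑ : ∀ n m →
  + length (filter (λ k → k ∣? n) (applyUpTo suc m)) ≡ ∑ m (λ k → divides01 (suc k) n)
numDivisors-∑ n zero    = refl
numDivisors-∑ n (suc m) = begin
  + length (filter (λ k → k ∣? n) (applyUpTo suc (suc m)))
    ≡⟨ cong (λ l → + length (filter (λ k → k ∣? n) l)) (applyUpTo-∷ʳ suc m) ⟨
  + length (filter (λ k → k ∣? n) (applyUpTo suc m ++ suc m ∷ []))
    ≡⟨ cong (λ l → + length l) (filter-++ (λ k → k ∣? n) (applyUpTo suc m) (suc m ∷ [])) ⟩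
  + length (filter (λ k → k ∣? n) (applyUpTo suc m) ++ filter (λ k → k ∣? n) (suc m ∷ []))
    ≡⟨ cong +_ (length-++ (filter (λ k → k ∣? n) (applyUpTo suc m))) ⟩
  + length (filter (λ k → k ∣? n) (applyUpTo suc m)) + + length (filter (λ k → k ∣? n) (suc m ∷ []))
    ≡⟨ cong₂ _+_ (numDivisors-∑ n m) singleton ⟩
  ∑ m (λ k → divides01 (suc k) n) + divides01 (suc m) n
    ∎
  where
  open ≡-Reasoning
  singleton : + length (filter (λ k → k ∣? n) (suc m ∷ [])) ≡ divides01 (suc m) n
  singleton with suc m ∣? n
  ... | yes d = trans (cong (λ l → + length l) (filter-accept (λ k → k ∣? n) d)) (sym (divides01-yes d))
  ... | no ¬d = trans (cong (λ l → + length l) (filter-reject (λ k → k ∣? n) ¬d)) (sym (divides01-no ¬d))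

-- The cutoff exceeds the exponent, so the remainder qᴺ `τ N` contributes nothing and `v-divides`
-- applies.
lsum-doubled-value : ∀ n →
  lsum term (doubled (suc (suc n)) (suc n)) ≡ (+ 1 + + (suc n / 2)) - + numDivisors (suc n)
lsum-doubled-value n
  rewrite lsum-doubled (suc (suc n)) (suc n) | ∑-τ (suc (suc n)) n
        | H-half (suc (suc n)) (suc n) (ℕₚ.n≤1+n (suc n))
        | seg-one {suc (suc n)} {n} (ℕₚ.n≤1+n (suc n))
        | v-divides (suc (suc n)) n ℕₚ.≤-refl
        | q·-low {suc (suc n)} {suc n} (τ (suc (suc n))) ℕₚ.≤-refl
        -- The cutoff brings in one candidate divisor beyond n + 1, and it does not divide n + 1.
        | divides01-low {suc (suc n)} {n} ℕₚ.≤-refl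
        | numDivisors-∑ (suc n) (suc n) =
  regroup (+ (suc n / 2)) (∑ (suc n) (λ k → divides01 (suc k) (suc n)))
  where
  regroup : ∀ h d → h + 1ℤ + - (d + 0ℤ) - 0ℤ ≡ 1ℤ + h - d
  regroup = solve-∀

-- Enumeration of 𝒟*(n)

module _ {A : Set} where

  ∈-shift⁻ : ∀ k (f : ℕ → List A) n {x} → x ∈ shift [] k f n → ∃ λ m → n ≡ k ℕ.+ m × x ∈ f m
  ∈-shift⁻ zero    f n       x∈ = n , refl , x∈
  ∈-shift⁻ (suc k) f (suc n) x∈ with ∈-shift⁻ k f n x∈
  ... | m , refl , x∈f = m , refl , x∈f

  ∈-shift⁺ : ∀ k (f : ℕ → List A) m {x} → x ∈ f m → x ∈ shift [] k f (k ℕ.+ m)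
  ∈-shift⁺ zero    f m x∈ = x∈
  ∈-shift⁺ (suc k) f m x∈ = ∈-shift⁺ k f m x∈

  shift-unique : ∀ k {f : ℕ → List A} n → (∀ m → Unique (f m)) → Unique (shift [] k f n)
  shift-unique zero    n       u = u n
  shift-unique (suc k) zero    u = []
  shift-unique (suc k) (suc n) u = shift-unique k n u

-- Prepending a + 1 to the chain expresses the bound on the parts and their distinctness at once,
-- and is the form in which the tail of a doubled partition appears.
∈-strict⁻ : ∀ a m {B} → B ∈ strict a m → Linked _>_ (suc a ∷ B) × All (1 ≤_) B × sum B ≡ m
∈-strict⁻ zero zero (here refl) = [-] , [] , refl
∈-strict⁻ (suc a) m B∈ with ∈-++⁻ (strict a m) B∈
... | inj₁ B∈ˡ with ∈-strict⁻ a m B∈ˡ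
...   | [-]     , pos , eq = [-] , pos , eq
...   | b< ∷ ls , pos , eq = ℕₚ.m<n⇒m<1+n b< ∷ ls , pos , eq
∈-strict⁻ (suc a) m B∈ | inj₂ B∈ʳ with ∈-shift⁻ (suc a) (map (suc a ∷_) ∘ strict a) m B∈ʳ
... | k , refl , B∈map with ∈-map⁻ (suc a ∷_) B∈map
...   | C , C∈ , refl with ∈-strict⁻ a k C∈
...     | ls , pos , refl = ℕₚ.≤-refl ∷ ls , s≤s z≤n ∷ pos , refl

∈-strict⁺ : ∀ a {B} → Linked _>_ (suc a ∷ B) → All (1 ≤_) B → B ∈ strict a (sum B)
∈-strict⁺ zero    [-]              _         = here refl
∈-strict⁺ zero    (s≤s b<1 ∷ _)    (1≤b ∷ _) = contradiction (ℕₚ.≤-trans 1≤b b<1) λ ()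
∈-strict⁺ (suc a) [-]              pos       = ∈-++⁺ˡ (∈-strict⁺ a [-] pos)
∈-strict⁺ (suc a) {b ∷ B} (b< ∷ ls) pos@(_ ∷ pos′) with b ℕ.≟ suc a
... | yes refl = ∈-++⁺ʳ (strict a (suc a ℕ.+ sum B))
  (∈-shift⁺ (suc a) (map (suc a ∷_) ∘ strict a) (sum B) (∈-map⁺ (suc a ∷_) (∈-strict⁺ a ls pos′)))
... | no  b≢a  = ∈-++⁺ˡ (∈-strict⁺ a (ℕₚ.≤∧≢⇒< (ℕₚ.≤-pred b<) b≢a ∷ ls) pos)

strict-unique : ∀ a m → Unique (strict a m)
strict-unique zero    zero    = [] ∷ []
strict-unique zero    (suc m) = []
strict-unique (suc a) m = Uniqueₚ.++⁺ (strict-unique a m)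
  (shift-unique (suc a) m λ k → Uniqueₚ.map⁺ ∷-injectiveʳ (strict-unique a k)) disjoint
  where
  disjoint : ∀ {B} → B ∈ strict a m × B ∈ shift [] (suc a) (map (suc a ∷_) ∘ strict a) m → ⊥
  disjoint (B∈ˡ , B∈ʳ) with ∈-shift⁻ (suc a) (map (suc a ∷_) ∘ strict a) m B∈ʳ
  ... | k , _ , B∈map with ∈-map⁻ (suc a ∷_) B∈map
  ...   | _ , _ , refl with ∈-strict⁻ a m B∈ˡ
  ...     | a<a ∷ _ , _ = ℕₚ.<-irrefl refl a<a

∈-doubled⁻ : ∀ N n {π} → π ∈ doubled N n →
  ∃ λ a → ∃₂ λ k B → a < N × n ≡ (suc a ℕ.+ suc a) ℕ.+ k × B ∈ strict a k × π ≡ suc a ∷ suc a ∷ B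
∈-doubled⁻ (suc a) n π∈ with ∈-++⁻ (doubled a n) π∈
... | inj₁ π∈ˡ with ∈-doubled⁻ a n π∈ˡ
...   | b , k , B , b<a , rest = b , k , B , ℕₚ.m<n⇒m<1+n b<a , rest
∈-doubled⁻ (suc a) n π∈ | inj₂ π∈ʳ
  with ∈-shift⁻ (suc a ℕ.+ suc a) (map (λ B → suc a ∷ suc a ∷ B) ∘ strict a) n π∈ʳ
... | k , n≡ , π∈map with ∈-map⁻ (λ B → suc a ∷ suc a ∷ B) π∈map
...   | B , B∈ , refl = a , k , B , ℕₚ.≤-refl , n≡ , B∈ , refl

∈-doubled⁺ : ∀ N {a k B} → a < N → B ∈ strict a k →
  (suc a ∷ suc a ∷ B) ∈ doubled N ((suc a ℕ.+ suc a) ℕ.+ k)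
∈-doubled⁺ (suc N) {a} {k} (s≤s a≤N) B∈ with a ℕ.≟ N
... | yes refl = ∈-++⁺ʳ (doubled a _)
  (∈-shift⁺ (suc a ℕ.+ suc a) (map (λ B → suc a ∷ suc a ∷ B) ∘ strict a) k
            (∈-map⁺ (λ B → suc a ∷ suc a ∷ B) B∈))
... | no  a≢N  = ∈-++⁺ˡ (∈-doubled⁺ N (ℕₚ.≤∧≢⇒< a≤N a≢N) B∈)

doubled-unique : ∀ N n → Unique (doubled N n)
doubled-unique zero    n = []
doubled-unique (suc a) n = Uniqueₚ.++⁺ (doubled-unique a n)
  (shift-unique (suc a ℕ.+ suc a) n λ k →
    Uniqueₚ.map⁺ (∷-injectiveʳ ∘ ∷-injectiveʳ) (strict-unique a k)) disjoint
  where
  disjoint : ∀ {π} → π ∈ doubled a n ×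
    π ∈ shift [] (suc a ℕ.+ suc a) (map (λ B → suc a ∷ suc a ∷ B) ∘ strict a) n → ⊥
  disjoint (π∈ˡ , π∈ʳ)
    with ∈-shift⁻ (suc a ℕ.+ suc a) (map (λ B → suc a ∷ suc a ∷ B) ∘ strict a) n π∈ʳ
  ... | _ , _ , π∈map with ∈-map⁻ (λ B → suc a ∷ suc a ∷ B) π∈map
  ...   | _ , _ , refl with ∈-doubled⁻ a n π∈ˡ
  ...     | _ , _ , _ , b<a , _ , _ , refl = ℕₚ.<-irrefl refl b<a

-- Multiplicities in sorted lists

count-≡ : ∀ x l → count x (x ∷ l) ≡ suc (count x l)
count-≡ x l = cong length (filter-accept (x ℕ.≟_) refl)

count-≢ : ∀ {x y} l → x ≢ y → count x (y ∷ l) ≡ count x l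
count-≢ {x} l x≢y = cong length (filter-reject (x ℕ.≟_) x≢y)

count-above : ∀ {x y l} → Linked _≥_ (y ∷ l) → y < x → count x (y ∷ l) ≡ 0
count-above {x} [-]               y<x = count-≢ [] (ℕₚ.>⇒≢ y<x)
count-above {x} {l = l} (y≥z ∷ d) y<x =
  trans (count-≢ l (ℕₚ.>⇒≢ y<x)) (count-above d (ℕₚ.≤-<-trans y≥z y<x))

largest-head : ∀ {x l} → Linked _≥_ (x ∷ l) → largest (x ∷ l) ≡ x
largest-head [-]       = ℕₚ.⊔-identityʳ _
largest-head (x≥y ∷ d) rewrite largest-head d = ℕₚ.m≥n⇒m⊔n≡m x≥y

strict⇒weak : ∀ {l} → Linked _>_ l → Linked _≥_ l
strict⇒weak []        = []
strict⇒weak [-]       = [-]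
strict⇒weak (x>y ∷ d) = ℕₚ.<⇒≤ x>y ∷ strict⇒weak d

strict⇒count≤1 : ∀ {l} → Linked _>_ l → ∀ u → count u l ≤ 1
strict⇒count≤1 []  u = z≤n
strict⇒count≤1 {x ∷ l} d u with u ℕ.≟ x
strict⇒count≤1 {x ∷ .[]} [-]   u | yes refl rewrite count-≡ u [] = ℕₚ.≤-refl
strict⇒count≤1 {x ∷ l} (x>y ∷ d) u | yes refl
  rewrite count-≡ u l | count-above (strict⇒weak d) x>y = ℕₚ.≤-refl
strict⇒count≤1 {x ∷ l} [-]       u | no u≢x rewrite count-≢ [] u≢x = z≤n
strict⇒count≤1 {x ∷ l} (_ ∷ d)   u | no u≢x rewrite count-≢ l u≢x = strict⇒count≤1 d u

count-∷-≥ : ∀ u x l → count u l ≤ count u (x ∷ l)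
count-∷-≥ u x l with u ℕ.≟ x
... | yes refl rewrite count-≡ u l = ℕₚ.n≤1+n _
... | no u≢x   rewrite count-≢ l u≢x = ℕₚ.≤-refl

count≤1⇒strict : ∀ {l} → Linked _≥_ l → (∀ u → count u l ≤ 1) → Linked _>_ l
count≤1⇒strict []  _ = []
count≤1⇒strict [-] _ = [-]
count≤1⇒strict {x ∷ y ∷ l} (x≥y ∷ d) c =
  ℕₚ.≤∧≢⇒< x≥y y≢x ∷ count≤1⇒strict d (λ u → ℕₚ.≤-trans (count-∷-≥ u x (y ∷ l)) (c u))
  where
  y≢x : y ≢ x
  y≢x refl with c x
  ... | c≤1 rewrite count-≡ x (x ∷ l) | count-≡ x l = contradiction c≤1 λ { (s≤s ()) }

IsDStar⁺ : ∀ {a k B} → B ∈ strict a k → 1 ≤ length B →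
  IsDStar ((suc a ℕ.+ suc a) ℕ.+ k) (suc a ∷ suc a ∷ B)
IsDStar⁺ {a} {k} {B} B∈ 1≤B with ∈-strict⁻ a k B∈
... | d , pos , refl =
  (((s≤s z≤n ∷ s≤s z≤n ∷ pos) , weak , sym (ℕₚ.+-assoc (suc a) (suc a) (sum B))) , repeated)
  , twice , s≤s (s≤s 1≤B)
  where
  weak : Linked _≥_ (suc a ∷ suc a ∷ B)
  weak = ℕₚ.≤-refl ∷ strict⇒weak d
  repeated : ∀ u → 2 ≤ count u (suc a ∷ suc a ∷ B) → u ≡ largest (suc a ∷ suc a ∷ B)
  repeated u 2≤ with u ℕ.≟ suc a
  ... | yes u≡a = trans u≡a (sym (largest-head weak))
  ... | no  u≢a = contradiction
    (ℕₚ.≤-trans (subst (2 ≤_) (count-≢ (suc a ∷ B) u≢a) 2≤) (strict⇒count≤1 d u)) λ { (s≤s ()) }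
  count-tail : ∀ {B} → Linked _>_ (suc a ∷ B) → count (suc a) B ≡ 0
  count-tail [-]     = refl
  count-tail (b< ∷ d) = count-above (strict⇒weak d) b<
  twice : count (largest (suc a ∷ suc a ∷ B)) (suc a ∷ suc a ∷ B) ≡ 2
  twice rewrite largest-head weak | count-≡ (suc a) (suc a ∷ B) | count-≡ (suc a) B
              | count-tail d = refl

-- In sorted order a second entry below the first would leave the largest part with multiplicity 1.
-- Once one of the two copies is removed, no part repeats, so the rest is strictly decreasing.
IsDStar⁻ : ∀ {n π} → IsDStar n π →
  ∃ λ a → ∃₂ λ k B → n ≡ (suc a ℕ.+ suc a) ℕ.+ k × B ∈ strict a k × π ≡ suc a ∷ suc a ∷ B
IsDStar⁻ {π = _ ∷ []}    (_ , _ , s≤s ())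
IsDStar⁻ {π = zero ∷ _ ∷ _}  (((() ∷ _ , _) , _) , _)
IsDStar⁻ {π = suc a ∷ y ∷ B}
  (((_ ∷ _ ∷ pos , weak@(a≥y ∷ d) , refl) , repeated) , twice , _)
  rewrite largest-head weak with y ℕ.≟ suc a
... | no y≢a = contradiction (trans (sym twice) once) λ ()
  where
  once : count (suc a) (suc a ∷ y ∷ B) ≡ 1
  once = trans (count-≡ (suc a) (y ∷ B)) (cong suc (count-above d (ℕₚ.≤∧≢⇒< a≥y y≢a)))
... | yes refl = a , sum B , B , sym (ℕₚ.+-assoc (suc a) (suc a) (sum B))
               , ∈-strict⁺ a (count≤1⇒strict d once) pos , refl
  where
  -- For the largest part this comes from its multiplicity being exactly two; any other part with
  -- two copies would have to be the largest.
  once : ∀ u → count u (suc a ∷ B) ≤ 1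
  once u with u ℕ.≟ suc a
  ... | yes refl = ℕₚ.≤-reflexive (ℕₚ.suc-injective (trans (sym (count-≡ u (u ∷ B))) twice))
  ... | no  u≢a  = ℕₚ.≤-pred (ℕₚ.≰⇒> λ 2≤ → u≢a (repeated u
                     (subst (2 ≤_) (sym (count-≢ (suc a ∷ B) u≢a)) 2≤)))

DStar-list : ℕ → List (List ℕ)
DStar-list n = filter (λ π → 3 ℕ.≤? length π) (doubled (suc n) n)

∈-DStar-list : ∀ n π → (π ∈ DStar-list n) ⇔ IsDStar n π
∈-DStar-list n π = mk⇔ to from
  where
  to : π ∈ DStar-list n → IsDStar n π
  to π∈ with ∈-filter⁻ (λ π → 3 ℕ.≤? length π) {xs = doubled (suc n) n} π∈
  ... | π∈d , 3≤ with ∈-doubled⁻ (suc n) n π∈d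
  ...   | a , k , B , _ , refl , B∈ , refl = IsDStar⁺ B∈ (ℕₚ.≤-pred (ℕₚ.≤-pred 3≤))
  from : IsDStar n π → π ∈ DStar-list n
  from D@(_ , _ , 3≤) with IsDStar⁻ D
  ... | a , k , B , refl , B∈ , refl =
    ∈-filter⁺ (λ π → 3 ℕ.≤? length π) (∈-doubled⁺ _ (s≤s a≤n) B∈) 3≤
    where
    a≤n : a ≤ (suc a ℕ.+ suc a) ℕ.+ k
    a≤n = ℕₚ.≤-trans (ℕₚ.n≤1+n a) (ℕₚ.≤-trans (ℕₚ.m≤m+n (suc a) (suc a)) (ℕₚ.m≤m+n _ k))

-- The filter only drops the pairs (a, a), whose term vanishes.
lsum-DStar-list : ∀ n → lsum term (DStar-list n) ≡ lsum term (doubled (suc n) n)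
lsum-DStar-list n = lsum-filter term (λ π → 3 ℕ.≤? length π) (doubled (suc n) n) short
  where
  short : ∀ {π} → π ∈ doubled (suc n) n → ¬ 3 ≤ length π → term π ≡ 0ℤ
  short π∈ ¬3≤ with ∈-doubled⁻ (suc n) n π∈
  ... | a , _ , []    , _ , _ , _ , refl = term-pair (suc a)
  ... | _ , _ , _ ∷ _ , _ , _ , _ , refl = contradiction (s≤s (s≤s (s≤s z≤n))) ¬3≤

-- Duplicate-free lists with the same members are permutations of each other, so the signed sum does
-- not depend on the chosen enumeration.
enumeration-↭ : ∀ n {ds} → Unique ds → (∀ π → (π ∈ ds) ⇔ IsDStar n π) → ds ↭ DStar-list n
enumeration-↭ n ds-unique ∈-ds = ∼bag⇒↭ (unique∧set⇒bag ds-unique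
  (Uniqueₚ.filter⁺ (λ π → 3 ℕ.≤? length π) (doubled-unique (suc n) n))
  λ {π} → mk⇔ (Equivalence.from (∈-DStar-list n π) ∘ Equivalence.to (∈-ds π))
              (Equivalence.from (∈-ds π) ∘ Equivalence.to (∈-DStar-list n π)))

theorem2p8 : (n : ℕ) → 1 ≤ n → (ds : List (List ℕ)) → Unique ds →
    (∀ π → (π ∈ ds) ⇔ IsDStar n π) →
    + numDivisors n ≡ (+ 1 + + (n / 2)) - sumℤ (map term ds)
theorem2p8 n@(suc m) _ ds ds-unique ∈-ds
  rewrite lsum-↭ term (enumeration-↭ n ds-unique ∈-ds) | lsum-DStar-list n | lsum-doubled-value m =
  regroup (+ numDivisors n) (+ 1 + + (n / 2))
  where
  regroup : ∀ d h → d ≡ h - (h - d)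
  regroup = solve-∀
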